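{- (One-dimensional $L^1$ regularity.) Let $\Sigma$ be a Boolean algebra with a fixed additive $\mu:\Sigma\to[0,1]$, $\mu(\Omega)=1$. Let $\nu:\Sigma\to\mathbb R$ be additive and absolutely continuous, let $\mathcal A$ be a partition, let $E,D$ be positive integers, and let $\mathbf B$ be a function on partitions. Then there exists a partition $\mathcal B_\sharp\succeq\mathcal A$ such that for every $\mathcal B\in[\mathcal B_\sharp,\mathbf B(\mathcal B_\sharp)]$, $$\mu\bigl(\mathfrak D_{E,\mathcal B_\sharp,\nu}(\mathcal B)\bigr)<\frac1D.$$
   Context: $\Sigma$ has largest element $\Omega$, least element $\emptyset$, operations $\cup,\cap$; $\sigma\subseteq\tau$ means $\sigma\cup\tau=\tau$. $\nu:\Sigma\to\mathbb R$ is additive if $\nu(\emptyset)=0$ and $\nu(\sigma\cup\tau)=\nu(\sigma)+\nu(\tau)-\nu(\sigma\cap\tau)$. A partition is a finite set $\mathcal A\subseteq\Sigma$ of pairwise disjoint elements (its union need not be $\Omega$). For $F:\Sigma\to\mathbb R$ put $F(\mathcal A)=\sum_{\sigma\in\mathcal A}F(\sigma)$; $|\nu|(\sigma)=|\nu(\sigma)|$, so $|\nu|(\mathcal A)=\sum_{\sigma\in\mathcal A}|\nu(\sigma)|$. $\mathcal A\preceq\mathcal B$ ($\mathcal B$ refines $\mathcal A$) if $\bigcup\mathcal A=\bigcup\mathcal B$ and every $\sigma\in\mathcal B$ is contained in some element of $\mathcal A$, denoted $\sigma_{\mathcal A}$. $[\mathcal A,\mathcal B]$ is the set of partitions $\mathcal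 C$ with $\mathcal A\preceq\mathcal C\preceq\mathcal B$. A function on partitions is a map $\mathbf B$ from partitions to partitions with $\mathcal A\preceq\mathbf B(\mathcal A)$ for all $\mathcal A$. $\nu$ is absolutely continuous if for every positive integer $E$ there is a positive integer $D$ such that $|\nu|(\mathcal A)<1/E$ for every partition $\mathcal A$ with $\mu(\mathcal A)<1/D$. $\delta_\nu(\sigma)=\nu(\sigma)/\mu(\sigma)$ (the convention when $\mu(\sigma)=0$ is immaterial here). For $\mathcal B_0\preceq\mathcal B$, $\mathfrak D_{E,\mathcal B_0,\nu}(\mathcal B)=\{\sigma\in\mathcal B: |\delta_\nu(\sigma)-\delta_\nu(\sigma_{\mathcal B_0})|\ge 1/E\}$. -}

module Defs where

open import Level using (Level; _⊔_; suc)
open import Algebra.Bundles using (CommutativeRing)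
open import Algebra.Structures using (IsCommutativeRing)
open import Algebra.Lattice.Bundles using (BooleanAlgebra)
import Algebra.Construct.NaturalChoice.Max as Max
import Algebra.Definitions.RawMonoid as RawMonoidDefs
open import Axiom.ExcludedMiddle using (ExcludedMiddle)
open import Data.List.Base using (List; map; foldr; filter)
open import Data.List.Relation.Unary.All as All using (All)
open import Data.List.Relation.Unary.AllPairs using (AllPairs)
open import Data.List.Relation.Unary.Any as Any using (Any)
import Data.List.Relation.Binary.Subset.Setoid as Subset
import Data.List.Relation.Unary.Unique.Setoid as UniqueSetoid
open import Data.Nat.Base using (ℕ; NonZero)
open import Data.Product.Base using (∃; Σ-syntax; _×_; proj₁; proj₂)
open import Relation.Binary.Bundles using (TotalOrder)
open import Relation.Binary.Core using (Rel)
open import Relation.Binary.Structures using (IsTotalOrder)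
open import Relation.Nullary.Negation.Core using (¬_)

-- The real numbers, up to isomorphism: a Dedekind-complete totally ordered
-- field.  The inverse is a total function about which nothing is assumed
-- at 0, so every convention for division by 0 is covered.
record CompleteOrderedField c ℓ₁ ℓ₂ : Set (suc (c ⊔ ℓ₁ ⊔ ℓ₂)) where
  infix  8 _⁻¹
  infix  8 -_
  infixl 7 _*_
  infixl 6 _+_ _-_
  infix  4 _≈_ _≤_ _<_
  field
    Carrier           : Set c
    _≈_               : Rel Carrier ℓ₁
    _≤_               : Rel Carrier ℓ₂
    _+_ _*_           : Carrier → Carrier → Carrier
    -_ _⁻¹            : Carrier → Carrier
    0# 1#             : Carrier
    isCommutativeRing : IsCommutativeRing _≈_ _+_ _*_ -_ 0# 1#
    1≉0               : ¬ (1# ≈ 0#)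
    ⁻¹-cong           : ∀ {x y} → x ≈ y → x ⁻¹ ≈ y ⁻¹
    ⁻¹-inverseʳ       : ∀ x → ¬ (x ≈ 0#) → x * x ⁻¹ ≈ 1#
    isTotalOrder      : IsTotalOrder _≈_ _≤_
    +-monoˡ-≤         : ∀ z {x y} → x ≤ y → x + z ≤ y + z
    *-nonNeg          : ∀ {x y} → 0# ≤ x → 0# ≤ y → 0# ≤ x * y

  UpperBound : (Carrier → Set (c ⊔ ℓ₁ ⊔ ℓ₂)) → Carrier → Set (c ⊔ ℓ₁ ⊔ ℓ₂)
  UpperBound P b = ∀ x → P x → x ≤ b

  field
    supremum : (P : Carrier → Set (c ⊔ ℓ₁ ⊔ ℓ₂)) → ∃ P → ∃ (UpperBound P) →
               Σ[ s ∈ Carrier ] UpperBound P s × (∀ b → UpperBound P b → s ≤ b)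

  commutativeRing : CommutativeRing c ℓ₁
  commutativeRing = record { isCommutativeRing = isCommutativeRing }

  totalOrder : TotalOrder c ℓ₁ ℓ₂
  totalOrder = record { isTotalOrder = isTotalOrder }

  _<_ : Rel Carrier (ℓ₁ ⊔ ℓ₂)
  x < y = x ≤ y × ¬ (x ≈ y)

  _-_ : Carrier → Carrier → Carrier
  x - y = x + (- y)

  ∣_∣ : Carrier → Carrier
  ∣ x ∣ = x ∨ (- x)
    where open Max totalOrder using () renaming (_⊔_ to _∨_)

  fromℕ : ℕ → Carrier
  fromℕ n = n · 1#
    where
    open RawMonoidDefs (CommutativeRing.+-rawMonoid commutativeRing)
      using () renaming (_×_ to _·_)

  1/_ : ℕ → Carrier
  1/ n = fromℕ n ⁻¹


module Regularity
  {c ℓ₁ ℓ₂ a ℓ : Level}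
  (R : CompleteOrderedField c ℓ₁ ℓ₂) (𝔹 : BooleanAlgebra a ℓ)
  where

  open CompleteOrderedField R public
    using (_≈_; _≤_; _<_; _+_; _*_; _-_; _⁻¹; 0#; 1#; ∣_∣; 1/_)
    renaming (Carrier to ℝ)
  open BooleanAlgebra 𝔹 public
    using (setoid)
    renaming ( Carrier to 𝕊; _≈_ to _≋_; _∨_ to _∪_; _∧_ to _∩_
             ; ⊤ to Ω; ⊥ to ∅ )

  infix 4 _⊆_ _≐_ _≼_

  _⊆_ : Rel 𝕊 ℓ
  σ ⊆ τ = σ ∪ τ ≋ τ

  record Additive (ν : 𝕊 → ℝ) : Set (a ⊔ ℓ ⊔ ℓ₁) where
    field
      cong     : ∀ {σ τ} → σ ≋ τ → ν σ ≈ ν τ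
      ν-∅      : ν ∅ ≈ 0#
      ν-∪      : ∀ σ τ → ν (σ ∪ τ) ≈ ν σ + ν τ - ν (σ ∩ τ)

  record Probability (μ : 𝕊 → ℝ) : Set (a ⊔ ℓ ⊔ ℓ₁ ⊔ ℓ₂) where
    field
      additive : Additive μ
      0≤μ      : ∀ σ → 0# ≤ μ σ
      μ≤1      : ∀ σ → μ σ ≤ 1#
      μ-Ω      : μ Ω ≈ 1#

  -- A finite set is a list without repetitions; in particular ∅ may occur,
  -- but at most once.
  record Partition : Set (a ⊔ ℓ) where
    field
      elements : List 𝕊
      unique   : UniqueSetoid.Unique setoid elements
      disjoint : AllPairs (λ σ τ → σ ∩ τ ≋ ∅) elements

  open Partition public using (elements)

  -- Equality of partitions as sets.
  _≐_ : Rel Partition (a ⊔ ℓ)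
  𝒜 ≐ ℬ = (elements 𝒜 ⊆ₗ elements ℬ) × (elements ℬ ⊆ₗ elements 𝒜)
    where open Subset setoid using () renaming (_⊆_ to _⊆ₗ_)

  ⋃ : List 𝕊 → 𝕊
  ⋃ = foldr _∪_ ∅

  sumOver : (𝕊 → ℝ) → List 𝕊 → ℝ
  sumOver F = foldr (λ σ s → F σ + s) 0#

  ∣_∣ᶠ : (𝕊 → ℝ) → 𝕊 → ℝ
  ∣ ν ∣ᶠ σ = ∣ ν σ ∣

  record _≼_ (𝒜 ℬ : Partition) : Set (a ⊔ ℓ) where
    field
      sameUnion : ⋃ (elements 𝒜) ≋ ⋃ (elements ℬ)
      contained : All (λ σ → Any (σ ⊆_) (elements 𝒜)) (elements ℬ)

  record PartitionFunction : Set (a ⊔ ℓ) where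
    field
      apply   : Partition → Partition
      cong    : ∀ {𝒜 ℬ} → 𝒜 ≐ ℬ → apply 𝒜 ≐ apply ℬ
      refines : ∀ 𝒜 → 𝒜 ≼ apply 𝒜

  AbsolutelyContinuous : (μ ν : 𝕊 → ℝ) → Set (a ⊔ ℓ ⊔ ℓ₁ ⊔ ℓ₂)
  AbsolutelyContinuous μ ν =
    ∀ (E : ℕ) → NonZero E → Σ[ D ∈ ℕ ] NonZero D ×
      (∀ (𝒜 : Partition) → sumOver μ (elements 𝒜) < 1/ D →
                           sumOver ∣ ν ∣ᶠ (elements 𝒜) < 1/ E)

  δ : (μ ν : 𝕊 → ℝ) → 𝕊 → ℝ
  δ μ ν σ = ν σ * μ σ ⁻¹

  -- The set 𝔇_{E,ℬ₀,ν}(ℬ).  For σ in ℬ, the element σ_{ℬ₀} is the one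
  -- singled out by the proof that ℬ refines ℬ₀.  It is determined up to ≋
  -- unless σ ≋ ∅, in which case any element of ℬ₀ may be singled out.
  -- Excluded middle decides membership in the comprehension.
  𝔇 : ExcludedMiddle ℓ₂ → (μ ν : 𝕊 → ℝ) (E : ℕ) (ℬ₀ ℬ : Partition) →
      ℬ₀ ≼ ℬ → List 𝕊
  𝔇 em μ ν E ℬ₀ ℬ ℬ₀≼ℬ = map proj₁ (filter (λ p → em {Deviates p}) (All.toList contained))
    where
    open _≼_ ℬ₀≼ℬ

    Deviates : (Σ[ σ ∈ 𝕊 ] Any (σ ⊆_) (elements ℬ₀)) → Set ℓ₂
    Deviates p = 1/ E ≤ ∣ δ μ ν (proj₁ p) - δ μ ν (Any.lookup (proj₂ p)) ∣

{-# OPTIONS --safe #-}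

-- Among the partitions refining 𝒜, choose one whose energy is nearly maximal: the
-- energy is the sum of μ·φ(ν/μ) for Huber's convex function φ, which is quadratic
-- on [-K, K] and linear outside.  It increases under refinement, and it is
-- bounded because φ has linear growth and ν, being absolutely continuous, has
-- bounded variation.  Every further refinement gains little energy.  By strict
-- convexity on [-K, K] the densities then move little in mean square, apart from
-- the elements of density above the cutoff, whose measure Markov's inequality
-- makes small.
module Submission where

-- The obstacle is that the density ν/μ need only be integrable: the quadratic energy, the sum of
-- ν²/μ, can grow without bound under refinement, while truncating the densities outright would
-- destroy the additivity behind its monotonicity. Huber's function keeps both bound and additivity,
-- being a maximum of affine functions of the density. Absolute continuity enters twice: it bounds
-- ν, and it makes ν vanish where μ does, so that ν is density times μ whatever the inverse of 0 is.
-- Constants: let e = 1/E, let η be half of 1/D and let V bound the variation. Densities above V/η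
-- occupy measure at most η. The cutoff K is V/η + e, the extra e keeping smaller densities away
-- from the ends of the interval. An energy slack of e²η leaves less than η for the remaining
-- elements.

open import Defs
open import Level using (Level; Lift; lift; _⊔_)
open import Algebra.Bundles using (CommutativeRing; RawRing)
open import Algebra.Lattice.Bundles using (BooleanAlgebra)
import Algebra.Construct.NaturalChoice.Max as Max
import Algebra.Lattice.Properties.BooleanAlgebra as BooleanAlgebraProperties
import Algebra.Properties.Ring as RingProperties
import Algebra.Properties.Semiring.Mult as SemiringMult
import Algebra.Solver.Ring as RingSolver
open import Algebra.Solver.Ring.AlmostCommutativeRing
  using (fromCommutativeRing; _-Raw-AlmostCommutative⟶_)
open import Axiom.ExcludedMiddle using (ExcludedMiddle)
open import Data.List.Base using (List; []; _∷_; map; foldr; filter)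
open import Data.List.Relation.Unary.All as All using (All; []; _∷_)
open import Data.List.Relation.Unary.AllPairs using (AllPairs; []; _∷_)
open import Data.List.Relation.Unary.Any as Any using (Any; here; there)
open import Data.Maybe.Base using (Maybe; just; nothing)
open import Data.Nat.Base as ℕ using (ℕ; zero; suc; NonZero)
import Data.Nat.Properties as ℕ
import Data.Product.Properties as ×
open import Data.Product.Base using (Σ-syntax; _×_; _,_; proj₁; proj₂)
open import Data.Sum.Base using (_⊎_; inj₁; inj₂; [_,_]′)
open import Function.Base using (_∘_)
open import Relation.Binary.Bundles using (TotalOrder)
open import Relation.Binary.PropositionalEquality.Core as ≡ using (_≡_)
import Relation.Binary.Reasoning.PartialOrder as ≤-Reasoning
import Relation.Binary.Reasoning.Setoid as ≈-Reasoning
open import Relation.Nullary using (Dec; yes; no; ¬_; contradiction)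
open import Relation.Nullary.Decidable using (True; toWitness; fromWitness; decidable-stable)

-- Integer coefficients for polynomial identities.

-- The integer coefficients of the ring solver are formal differences: (a , b)
-- stands for a - b.  They are kept reduced, because the solver compares normal
-- forms syntactically.
module DifferenceSolver {c ℓ} (C : CommutativeRing c ℓ) where

  open CommutativeRing C hiding (zero)
  open RingProperties ring
  open SemiringMult semiring using (×-homo-+; ×1-homo-*) renaming (_×_ to _·_)
  open ≈-Reasoning setoid

  reduce : ℕ × ℕ → ℕ × ℕ
  reduce (suc a , suc b) = reduce (a , b)
  reduce (zero , b) = zero , b
  reduce (suc a , zero) = suc a , zero

  differences : RawRing _ _
  differences = record
    { Carrier = ℕ × ℕ
    ; _≈_ = _≡_
    ; _+_ = λ (a , b) (a′ , b′) → reduce (a ℕ.+ a′ , b ℕ.+ b′)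
    ; _*_ = λ (a , b) (a′ , b′) → reduce (a ℕ.* a′ ℕ.+ b ℕ.* b′ , a ℕ.* b′ ℕ.+ b ℕ.* a′)
    ; -_ = λ (a , b) → b , a
    ; 0# = 0 , 0
    ; 1# = 1 , 0
    }

  difference : ℕ × ℕ → Carrier
  difference (a , b) = a · 1# - b · 1#

  interchange : ∀ x y z w → (x + y) + (z + w) ≈ (x + z) + (y + w)
  interchange x y z w = begin
    (x + y) + (z + w) ≈⟨ +-assoc x y (z + w) ⟩
    x + (y + (z + w)) ≈⟨ +-congˡ (trans (sym (+-assoc y z w)) (trans (+-congʳ (+-comm y z)) (+-assoc z y w))) ⟩
    x + (z + (y + w)) ≈⟨ sym (+-assoc x z (y + w)) ⟩
    (x + z) + (y + w) ∎

  difference-reduce : ∀ x → difference (reduce x) ≈ difference x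
  difference-reduce (zero , b) = refl
  difference-reduce (suc a , zero) = refl
  difference-reduce (suc a , suc b) = begin
    difference (reduce (a , b))               ≈⟨ difference-reduce (a , b) ⟩
    a · 1# - b · 1#                           ≈⟨ +-identityˡ _ ⟨
    0# + (a · 1# - b · 1#)                    ≈⟨ +-congʳ (-‿inverseʳ 1#) ⟨
    (1# - 1#) + (a · 1# - b · 1#)             ≈⟨ interchange _ _ _ _ ⟩
    (1# + a · 1#) + (- 1# + - (b · 1#))       ≈⟨ +-congˡ (-‿+-comm _ _) ⟩
    (1# + a · 1#) - (1# + b · 1#)             ∎

  difference-+ : ∀ x y → difference (RawRing._+_ differences x y) ≈ difference x + difference y
  difference-+ (a , b) (a′ , b′) = begin
    difference (reduce (a ℕ.+ a′ , b ℕ.+ b′)) ≈⟨ difference-reduce (a ℕ.+ a′ , b ℕ.+ b′) ⟩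
    (a ℕ.+ a′) · 1# - (b ℕ.+ b′) · 1#         ≈⟨ +-cong (×-homo-+ 1# a a′) (-‿cong (×-homo-+ 1# b b′)) ⟩
    (a · 1# + a′ · 1#) - (b · 1# + b′ · 1#)   ≈⟨ +-congˡ (-‿+-comm _ _) ⟨
    (a · 1# + a′ · 1#) + (- (b · 1#) + - (b′ · 1#)) ≈⟨ interchange _ _ _ _ ⟩
    difference (a , b) + difference (a′ , b′) ∎

  difference-* : ∀ x y → difference (RawRing._*_ differences x y) ≈ difference x * difference y
  difference-* (a , b) (a′ , b′) = begin
    difference (reduce (a ℕ.* a′ ℕ.+ b ℕ.* b′ , a ℕ.* b′ ℕ.+ b ℕ.* a′))
      ≈⟨ difference-reduce (a ℕ.* a′ ℕ.+ b ℕ.* b′ , a ℕ.* b′ ℕ.+ b ℕ.* a′) ⟩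
    (a ℕ.* a′ ℕ.+ b ℕ.* b′) · 1# - (a ℕ.* b′ ℕ.+ b ℕ.* a′) · 1#
      ≈⟨ +-cong (expand a a′ b b′) (-‿cong (expand a b′ b a′)) ⟩
    (p * p′ + q * q′) - (p * q′ + q * p′)
      ≈⟨ +-congˡ (-‿+-comm _ _) ⟨
    (p * p′ + q * q′) + (- (p * q′) + - (q * p′))
      ≈⟨ +-congˡ (+-comm _ _) ⟩
    (p * p′ + q * q′) + (- (q * p′) + - (p * q′))
      ≈⟨ interchange _ _ _ _ ⟩
    (p * p′ - q * p′) + (q * q′ - p * q′)
      ≈⟨ +-cong (sym (trans (distribʳ _ _ _) (+-congˡ (sym (-‿distribˡ-* _ _)))))
           (trans (+-comm _ _) (sym rest)) ⟩
    (p - q) * p′ + (p - q) * - q′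
      ≈⟨ distribˡ _ _ _ ⟨
    (p - q) * (p′ - q′) ∎
    where
    p = a · 1#
    q = b · 1#
    p′ = a′ · 1#
    q′ = b′ · 1#
    expand : ∀ m m′ n n′ → (m ℕ.* m′ ℕ.+ n ℕ.* n′) · 1# ≈ (m · 1#) * (m′ · 1#) + (n · 1#) * (n′ · 1#)
    expand m m′ n n′ = trans (×-homo-+ 1# (m ℕ.* m′) (n ℕ.* n′)) (+-cong (×1-homo-* m m′) (×1-homo-* n n′))
    rest : (p - q) * - q′ ≈ - (p * q′) + q * q′
    rest = trans (distribʳ _ _ _) (+-cong (sym (-‿distribʳ-* _ _)) (trans (sym (-‿distribˡ-* _ _)) (trans (-‿cong (sym (-‿distribʳ-* _ _))) (-‿involutive _))))

  morphism : differences -Raw-AlmostCommutative⟶ fromCommutativeRing C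
  morphism = record
    { ⟦_⟧ = difference
    ; +-homo = difference-+
    ; *-homo = difference-*
    ; -‿homo = λ (a , b) → trans (+-comm _ _) (trans (+-congˡ (sym (-‿involutive _))) (-‿+-comm _ _))
    ; 0-homo = -‿inverseʳ 0#
    ; 1-homo = trans (+-congˡ -0#≈0#) (trans (+-identityʳ _) (+-identityʳ _))
    }

  weaklyDecide : ∀ x y → Maybe (difference x ≈ difference y)
  weaklyDecide x y with ×.≡-dec ℕ._≟_ ℕ._≟_ x y
  ... | yes eq = just (reflexive (≡.cong difference eq))
  ... | no _ = nothing

  open RingSolver differences (fromCommutativeRing C) morphism weaklyDecide public
    using (solve; _:+_; _:*_; _:-_; :-_; _:=_)

-- Order, inverses and absolute values in a complete ordered field.

module OrderedField {c ℓ₁ ℓ₂} (R : CompleteOrderedField c ℓ₁ ℓ₂) where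

  open CompleteOrderedField R public
    using (Carrier; _≈_; _≤_; _<_; _+_; _*_; -_; _-_; _⁻¹; 0#; 1#; ∣_∣; 1/_; fromℕ
          ; totalOrder; commutativeRing; 1≉0; ⁻¹-inverseʳ; +-monoˡ-≤; *-nonNeg; supremum)
  open CommutativeRing commutativeRing public
    using (setoid; refl; sym; trans; reflexive; +-cong; +-congˡ; +-congʳ; *-cong; *-congˡ; *-congʳ; -‿cong
          ; +-comm; +-assoc; *-comm; *-assoc; +-identityˡ; +-identityʳ; *-identityˡ; *-identityʳ
          ; zeroˡ; zeroʳ; distribˡ; distribʳ; -‿inverseʳ)
  open TotalOrder totalOrder public
    using (poset; antisym; total)
    renaming (refl to ≤-refl; trans to ≤-trans; reflexive to ≤-reflexive)
  open DifferenceSolver commutativeRing public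
  open ≤-Reasoning poset public
  private
    module Abs = Max totalOrder

  <⇒≤ : ∀ {x y} → x < y → x ≤ y
  <⇒≤ = proj₁

  <⇒≱ : ∀ {x y} → x < y → ¬ (y ≤ x)
  <⇒≱ (x≤y , x≉y) y≤x = x≉y (antisym x≤y y≤x)

  ≰⇒> : ∀ {x y} → ¬ (x ≤ y) → y < x
  ≰⇒> {x} {y} x≰y with total x y
  ... | inj₁ x≤y = contradiction x≤y x≰y
  ... | inj₂ y≤x = y≤x , λ y≈x → x≰y (≤-reflexive (sym y≈x))

  +-mono : ∀ {x y z w} → x ≤ y → z ≤ w → x + z ≤ y + w
  +-mono {x} {y} {z} {w} x≤y z≤w = begin
    x + z ≤⟨ +-monoˡ-≤ z x≤y ⟩
    y + z ≈⟨ +-comm y z ⟩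
    z + y ≤⟨ +-monoˡ-≤ y z≤w ⟩
    w + y ≈⟨ +-comm w y ⟩
    y + w ∎

  +-monoʳ : ∀ x {y z} → y ≤ z → x + y ≤ x + z
  +-monoʳ x = +-mono ≤-refl

  x≤y⇒0≤y-x : ∀ {x y} → x ≤ y → 0# ≤ y - x
  x≤y⇒0≤y-x {x} {y} x≤y = begin
    0#    ≈⟨ -‿inverseʳ x ⟨
    x - x ≤⟨ +-monoˡ-≤ (- x) x≤y ⟩
    y - x ∎

  0≤y-x⇒x≤y : ∀ {x y} → 0# ≤ y - x → x ≤ y
  0≤y-x⇒x≤y {x} {y} 0≤y-x = begin
    x           ≈⟨ +-identityʳ x ⟨
    x + 0#      ≤⟨ +-monoʳ x 0≤y-x ⟩
    x + (y - x) ≈⟨ solve 2 (λ x y → x :+ (y :- x) := y) refl x y ⟩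
    y           ∎

  +-cancelˡ : ∀ z {x y} → z + x ≤ z + y → x ≤ y
  +-cancelˡ z {x} {y} zx≤zy = 0≤y-x⇒x≤y (begin
    0#                ≤⟨ x≤y⇒0≤y-x zx≤zy ⟩
    (z + y) - (z + x) ≈⟨ solve 3 (λ x y z → (z :+ y) :- (z :+ x) := y :- x) refl x y z ⟩
    y - x             ∎)

  +-monoʳ-< : ∀ z {x y} → x < y → z + x < z + y
  +-monoʳ-< z x<y = ≰⇒> (<⇒≱ x<y ∘ +-cancelˡ z)

  neg-mono : ∀ {x y} → x ≤ y → - y ≤ - x
  neg-mono {x} {y} x≤y = 0≤y-x⇒x≤y (begin
    0#          ≤⟨ x≤y⇒0≤y-x x≤y ⟩
    y - x       ≈⟨ solve 2 (λ x y → y :- x := :- x :- :- y) refl x y ⟩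
    - x - (- y) ∎)

  neg-involutive : ∀ x → - (- x) ≈ x
  neg-involutive = solve 1 (λ x → :- (:- x) := x) refl

  0≤-x : ∀ {x} → x ≤ 0# → 0# ≤ - x
  0≤-x {x} x≤0 = begin
    0#     ≤⟨ x≤y⇒0≤y-x x≤0 ⟩
    0# - x ≈⟨ +-identityˡ (- x) ⟩
    - x    ∎

  +-nonNeg : ∀ {x y} → 0# ≤ x → 0# ≤ y → 0# ≤ x + y
  +-nonNeg {x} {y} 0≤x 0≤y = begin
    0#      ≈⟨ +-identityˡ 0# ⟨
    0# + 0# ≤⟨ +-mono 0≤x 0≤y ⟩
    x + y   ∎

  -x≤x : ∀ {x} → 0# ≤ x → - x ≤ x
  -x≤x {x} 0≤x = 0≤y-x⇒x≤y (≤-trans (+-nonNeg 0≤x 0≤x) (≤-reflexive (+-congˡ (sym (neg-involutive x)))))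

  +-pos-nonNeg : ∀ {x y} → 0# < x → 0# ≤ y → 0# < x + y
  +-pos-nonNeg {x} {y} 0<x 0≤y = begin-strict
    0#      <⟨ 0<x ⟩
    x       ≈⟨ +-identityʳ x ⟨
    x + 0#  ≤⟨ +-monoʳ x 0≤y ⟩
    x + y   ∎

  *-monoʳ : ∀ {z x y} → 0# ≤ z → x ≤ y → z * x ≤ z * y
  *-monoʳ {z} {x} {y} 0≤z x≤y = 0≤y-x⇒x≤y (begin
    0#            ≤⟨ *-nonNeg 0≤z (x≤y⇒0≤y-x x≤y) ⟩
    z * (y - x)   ≈⟨ solve 3 (λ x y z → z :* (y :- x) := z :* y :- z :* x) refl x y z ⟩
    z * y - z * x ∎)

  *-monoˡ : ∀ {z x y} → 0# ≤ z → x ≤ y → x * z ≤ y * z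
  *-monoˡ {z} {x} {y} 0≤z x≤y = begin
    x * z ≈⟨ *-comm x z ⟩
    z * x ≤⟨ *-monoʳ 0≤z x≤y ⟩
    z * y ≈⟨ *-comm z y ⟩
    y * z ∎

  *-nonPos : ∀ {x y} → x ≤ 0# → y ≤ 0# → 0# ≤ x * y
  *-nonPos {x} {y} x≤0 y≤0 = begin
    0#            ≤⟨ *-nonNeg (0≤-x x≤0) (0≤-x y≤0) ⟩
    (- x) * (- y) ≈⟨ solve 2 (λ x y → (:- x) :* (:- y) := x :* y) refl x y ⟩
    x * y         ∎

  square-nonNeg : ∀ x → 0# ≤ x * x
  square-nonNeg x = [ (λ 0≤x → *-nonNeg 0≤x 0≤x) , (λ x≤0 → *-nonPos x≤0 x≤0) ]′ (total 0# x)

  0<1 : 0# < 1#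
  0<1 = (begin
    0#      ≤⟨ square-nonNeg 1# ⟩
    1# * 1# ≈⟨ *-identityˡ 1# ⟩
    1#      ∎) , 1≉0 ∘ sym

  ⁻¹-pos : ∀ {x} → 0# < x → 0# < x ⁻¹
  ⁻¹-pos {x} (0≤x , 0≉x) = ≰⇒> λ x⁻¹≤0 → <⇒≱ 0<1 (begin
    1#       ≈⟨ ⁻¹-inverseʳ x (0≉x ∘ sym) ⟨
    x * x ⁻¹ ≤⟨ *-monoʳ 0≤x x⁻¹≤0 ⟩
    x * 0#   ≈⟨ zeroʳ x ⟩
    0#       ∎)

  *-cancelˡ : ∀ {z x y} → 0# < z → z * x ≤ z * y → x ≤ y
  *-cancelˡ {z} {x} {y} 0<z zx≤zy = begin
    x              ≈⟨ unit x ⟨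
    z ⁻¹ * (z * x) ≤⟨ *-monoʳ (<⇒≤ (⁻¹-pos 0<z)) zx≤zy ⟩
    z ⁻¹ * (z * y) ≈⟨ unit y ⟩
    y              ∎
    where
    unit : ∀ w → z ⁻¹ * (z * w) ≈ w
    unit w = begin-equality
      z ⁻¹ * (z * w) ≈⟨ *-assoc (z ⁻¹) z w ⟨
      z ⁻¹ * z * w   ≈⟨ *-congʳ (*-comm (z ⁻¹) z) ⟩
      z * z ⁻¹ * w   ≈⟨ *-congʳ (⁻¹-inverseʳ z (proj₂ 0<z ∘ sym)) ⟩
      1# * w         ≈⟨ *-identityˡ w ⟩
      w              ∎

  *-monoʳ-< : ∀ {z x y} → 0# < z → x < y → z * x < z * y
  *-monoʳ-< 0<z x<y = ≰⇒> (<⇒≱ x<y ∘ *-cancelˡ 0<z)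

  *-pos : ∀ {x y} → 0# < x → 0# < y → 0# < x * y
  *-pos {x} {y} 0<x 0<y = begin-strict
    0#     ≈⟨ zeroʳ x ⟨
    x * 0# <⟨ *-monoʳ-< 0<x 0<y ⟩
    x * y  ∎

  fromℕ-nonNeg : ∀ n → 0# ≤ fromℕ n
  fromℕ-nonNeg zero = ≤-refl
  fromℕ-nonNeg (suc n) = +-nonNeg (<⇒≤ 0<1) (fromℕ-nonNeg n)

  1/-pos : ∀ n → NonZero n → 0# < 1/ n
  1/-pos (suc n) _ = ⁻¹-pos (+-pos-nonNeg 0<1 (fromℕ-nonNeg n))

  quotient : ∀ {x y} → 0# < x → 0# < y → Σ[ z ∈ Carrier ] 0# < z × z * y ≈ x
  quotient {x} {y} 0<x 0<y = x * y ⁻¹ , *-pos 0<x (⁻¹-pos 0<y) , (begin-equality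
    x * y ⁻¹ * y   ≈⟨ *-assoc x (y ⁻¹) y ⟩
    x * (y ⁻¹ * y) ≈⟨ *-congˡ (trans (*-comm (y ⁻¹) y) (⁻¹-inverseʳ y (proj₂ 0<y ∘ sym))) ⟩
    x * 1#         ≈⟨ *-identityʳ x ⟩
    x              ∎)

  half : ∀ {x} → 0# < x → Σ[ y ∈ Carrier ] 0# < y × y + y ≈ x
  half {x} 0<x =
    let (y , 0<y , y*2≈x) = quotient 0<x (+-pos-nonNeg 0<1 (<⇒≤ 0<1))
    in y , 0<y , trans (sym (trans (distribˡ y 1# 1#) (+-cong (*-identityʳ y) (*-identityʳ y)))) y*2≈x

  x≤∣x∣ : ∀ x → x ≤ ∣ x ∣
  x≤∣x∣ x = Abs.x≤x⊔y x (- x)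

  -x≤∣x∣ : ∀ x → - x ≤ ∣ x ∣
  -x≤∣x∣ x = Abs.x≤y⊔x x (- x)

  ∣x∣≤ : ∀ {x y} → x ≤ y → - x ≤ y → ∣ x ∣ ≤ y
  ∣x∣≤ = Abs.⊔-lub

  ∣∣-cong : ∀ {x y} → x ≈ y → ∣ x ∣ ≤ ∣ y ∣
  ∣∣-cong {x} {y} x≈y = ∣x∣≤
    (≤-trans (≤-reflexive x≈y) (x≤∣x∣ y))
    (≤-trans (≤-reflexive (-‿cong x≈y)) (-x≤∣x∣ y))

  ∣∣-sign : ∀ x → (0# ≤ x × ∣ x ∣ ≈ x) ⊎ (x ≤ 0# × ∣ x ∣ ≈ - x)
  ∣∣-sign x with total 0# x
  ... | inj₁ 0≤x = inj₁ (0≤x , antisym (∣x∣≤ ≤-refl (-x≤x 0≤x)) (x≤∣x∣ x))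
  ... | inj₂ x≤0 = inj₂ (x≤0 , antisym (∣x∣≤ (≤-trans x≤0 (0≤-x x≤0)) ≤-refl) (-x≤∣x∣ x))

  -- Truncation to an interval.

  -- The value is the nearest point of [-K, K] to x.
  record Clamp (K x : Carrier) : Set (c ⊔ ℓ₁ ⊔ ℓ₂) where
    field
      value    : Carrier
      lower    : - K ≤ value
      upper    : value ≤ K
      -- The variational inequality of projection onto a convex set. It makes the cross term in
      -- `affine-gap` nonnegative.
      obtuse   : ∀ {s} → - K ≤ s → s ≤ K → 0# ≤ (x - value) * (value - s)
      fixed    : - K ≤ x → x ≤ K → value ≈ x
      -- Truncation either fixes `x` or moves it to an endpoint, and a point `y` at depth `e` inside
      -- the interval is at least `e` away from both endpoints.
      separate : ∀ {y e} → - K + e ≤ y → y + e ≤ K → e ≤ ∣ y - x ∣ → e ≤ ∣ y - value ∣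

  clamp : ∀ {K} → 0# ≤ K → ∀ x → Clamp K x
  clamp {K} 0≤K x with total x (- K) | total x K
  ... | inj₁ x≤-K | _ = record
    { value = - K
    ; lower = ≤-refl
    ; upper = -x≤x 0≤K
    ; obtuse = λ -K≤s _ → *-nonPos (x-y≤0 x≤-K) (x-y≤0 -K≤s)
    ; fixed = λ -K≤x _ → antisym -K≤x x≤-K
    ; separate = λ {y} {e} -K+e≤y _ _ → ≤-trans (+-cancelˡ (- K) (≤-trans -K+e≤y (≤-reflexive
        (solve 2 (λ y k → y := :- k :+ (y :- :- k)) refl y K)))) (x≤∣x∣ _)
    }
    where
    x-y≤0 : ∀ {x y} → x ≤ y → x - y ≤ 0#
    x-y≤0 {x} {y} x≤y = ≤-trans (+-monoˡ-≤ (- y) x≤y) (≤-reflexive (-‿inverseʳ y))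
  ... | inj₂ -K≤x | inj₁ x≤K = record
    { value = x
    ; lower = -K≤x
    ; upper = x≤K
    ; obtuse = λ {s} _ _ → ≤-reflexive (sym (trans (*-congʳ (-‿inverseʳ x)) (zeroˡ (x - s))))
    ; fixed = λ _ _ → refl
    ; separate = λ _ _ e≤∣y-x∣ → e≤∣y-x∣
    }
  ... | inj₂ -K≤x | inj₂ K≤x = record
    { value = K
    ; lower = -x≤x 0≤K
    ; upper = ≤-refl
    ; obtuse = λ _ s≤K → *-nonNeg (x≤y⇒0≤y-x K≤x) (x≤y⇒0≤y-x s≤K)
    ; fixed = λ _ x≤K → antisym K≤x x≤K
    ; separate = λ {y} {e} _ y+e≤K _ → ≤-trans (+-cancelˡ y (≤-trans y+e≤K (≤-reflexive
        (solve 2 (λ y k → k := y :+ :- (y :- k)) refl y K)))) (-x≤∣x∣ _)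
    }

  square-mono-∣∣ : ∀ {e d} → 0# ≤ e → e ≤ ∣ d ∣ → e * e ≤ d * d
  square-mono-∣∣ {e} {d} 0≤e e≤∣d∣ = begin
    e * e         ≤⟨ *-monoʳ 0≤e e≤∣d∣ ⟩
    e * ∣ d ∣     ≤⟨ *-monoˡ (≤-trans 0≤e e≤∣d∣) e≤∣d∣ ⟩
    ∣ d ∣ * ∣ d ∣ ≈⟨ square-∣∣ ⟩
    d * d         ∎
    where
    square-∣∣ : ∣ d ∣ * ∣ d ∣ ≈ d * d
    square-∣∣ with ∣∣-sign d
    ... | inj₁ (_ , ∣d∣≈d) = *-cong ∣d∣≈d ∣d∣≈d
    ... | inj₂ (_ , ∣d∣≈-d) = trans (*-cong ∣d∣≈-d ∣d∣≈-d) (solve 1 (λ d → :- d :* :- d := d :* d) refl d)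

  ∣∣-nonNeg : ∀ x → 0# ≤ ∣ x ∣
  ∣∣-nonNeg x with total 0# x
  ... | inj₁ 0≤x = ≤-trans 0≤x (x≤∣x∣ x)
  ... | inj₂ x≤0 = ≤-trans (0≤-x x≤0) (-x≤∣x∣ x)

  ∣∣-+ : ∀ x y → ∣ x + y ∣ ≤ ∣ x ∣ + ∣ y ∣
  ∣∣-+ x y = ∣x∣≤ (+-mono (x≤∣x∣ x) (x≤∣x∣ y)) (begin
    - (x + y)     ≈⟨ solve 2 (λ x y → :- (x :+ y) := :- x :+ :- y) refl x y ⟩
    - x + - y     ≤⟨ +-mono (-x≤∣x∣ x) (-x≤∣x∣ y) ⟩
    ∣ x ∣ + ∣ y ∣ ∎)

  *-≤-∣∣ : ∀ {K t} n → - K ≤ t → t ≤ K → t * n ≤ K * ∣ n ∣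
  *-≤-∣∣ {K} {t} n -K≤t t≤K with ∣∣-sign n
  ... | inj₁ (0≤n , ∣n∣≈n) = ≤-trans (*-monoˡ 0≤n t≤K) (≤-reflexive (*-congˡ (sym ∣n∣≈n)))
  ... | inj₂ (n≤0 , ∣n∣≈-n) = begin
    t * n         ≈⟨ solve 2 (λ t n → t :* n := (:- t) :* (:- n)) refl t n ⟩
    (- t) * (- n) ≤⟨ *-monoˡ (0≤-x n≤0) (≤-trans (neg-mono -K≤t) (≤-reflexive (neg-involutive K))) ⟩
    K * - n       ≈⟨ *-congˡ ∣n∣≈-n ⟨
    K * ∣ n ∣     ∎

  -- Finite sums.

  ∑ : ∀ {i} {I : Set i} → (I → Carrier) → List I → Carrier
  ∑ f = foldr (λ i s → f i + s) 0#

  private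
    variable
      i j : Level
      I : Set i
      J : Set j

  ∑-cong-All : ∀ {f g : I → Carrier} {xs} → All (λ x → f x ≈ g x) xs → ∑ f xs ≈ ∑ g xs
  ∑-cong-All [] = refl
  ∑-cong-All (fx≈gx ∷ eqs) = +-cong fx≈gx (∑-cong-All eqs)

  ∑-mono : ∀ {f g : I → Carrier} → (∀ x → f x ≤ g x) → ∀ xs → ∑ f xs ≤ ∑ g xs
  ∑-mono f≤g [] = ≤-refl
  ∑-mono f≤g (x ∷ xs) = +-mono (f≤g x) (∑-mono f≤g xs)

  ∑-cong : ∀ {f g : I → Carrier} → (∀ x → f x ≈ g x) → ∀ xs → ∑ f xs ≈ ∑ g xs
  ∑-cong f≈g xs = ∑-cong-All (All.universal f≈g xs)

  ∑-zero : ∀ {f : I → Carrier} {xs} → All (λ x → f x ≈ 0#) xs → ∑ f xs ≈ 0#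
  ∑-zero [] = refl
  ∑-zero (fx≈0 ∷ eqs) = trans (+-cong fx≈0 (∑-zero eqs)) (+-identityˡ 0#)

  ∑-+ : ∀ (f g : I → Carrier) xs → ∑ (λ x → f x + g x) xs ≈ ∑ f xs + ∑ g xs
  ∑-+ f g [] = sym (+-identityˡ 0#)
  ∑-+ f g (x ∷ xs) = trans (+-congˡ (∑-+ f g xs))
    (solve 4 (λ a b c d → (a :+ b) :+ (c :+ d) := (a :+ c) :+ (b :+ d)) refl (f x) (g x) (∑ f xs) (∑ g xs))

  ∑-* : ∀ a (f : I → Carrier) xs → ∑ (λ x → a * f x) xs ≈ a * ∑ f xs
  ∑-* a f [] = sym (zeroʳ a)
  ∑-* a f (x ∷ xs) = trans (+-congˡ (∑-* a f xs)) (sym (distribˡ a (f x) (∑ f xs)))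

  ∑-swap : ∀ (f : I → J → Carrier) xs ys →
           ∑ (λ x → ∑ (f x) ys) xs ≈ ∑ (λ y → ∑ (λ x → f x y) xs) ys
  ∑-swap f [] ys = sym (∑-zero (All.universal (λ _ → refl) ys))
  ∑-swap f (x ∷ xs) ys = trans (+-congˡ (∑-swap f xs ys)) (sym (∑-+ (f x) (λ y → ∑ (λ x → f x y) xs) ys))

  -- Dropped terms cost nothing because `g` is nonnegative. In the application `r` forgets the
  -- witness of containment, on which `g` still depends.
  ∑-filter-≤ : ∀ {p} {P : I → Set p} (P? : ∀ x → Dec (P x)) {r : I → J} {f : J → Carrier} {g : I → Carrier} →
               (∀ x → P x → f (r x) ≤ g x) → (∀ x → 0# ≤ g x) →
               ∀ xs → ∑ f (map r (filter P? xs)) ≤ ∑ g xs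
  ∑-filter-≤ P? f≤g 0≤g [] = ≤-refl
  ∑-filter-≤ P? f≤g 0≤g (x ∷ xs) with P? x
  ... | yes Px = +-mono (f≤g x Px) (∑-filter-≤ P? f≤g 0≤g xs)
  ... | no _ = ≤-trans (≤-reflexive (sym (+-identityˡ _))) (+-mono (0≤g x) (∑-filter-≤ P? f≤g 0≤g xs))

  ∑-toList : ∀ {p} {P : I → Set p} (f : I → Carrier) {xs} (pxs : All P xs) →
             ∑ (f ∘ proj₁) (All.toList pxs) ≈ ∑ f xs
  ∑-toList f [] = refl
  ∑-toList f (px ∷ pxs) = +-congˡ (∑-toList f pxs)

  -- Suprema and the Archimedean property.

  -- `True (em {P})` is a copy of P in the lowest universe, so that the supremum
  -- of a family over an arbitrarily large index type exists.
  near-supremum : (∀ {p} → ExcludedMiddle p) → ∀ {i} {I : Set i} (f : I → Carrier) {b} →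
                  I → (∀ j → f j ≤ b) → ∀ {ε} → 0# < ε → Σ[ k ∈ I ] ∀ j → f j < f k + ε
  near-supremum em {I = I} f {b} i₀ f≤b {ε} 0<ε = near em
    where
    Value : Carrier → Set (c ⊔ ℓ₁ ⊔ ℓ₂)
    Value x = Lift _ (True (em {P = Σ[ j ∈ I ] f j ≈ x}))
    Value≤b : ∀ x → Value x → x ≤ b
    Value≤b x (lift v) = let (j , fj≈x) = toWitness v in ≤-trans (≤-reflexive (sym fj≈x)) (f≤b j)
    supremumOfValues = supremum Value (f i₀ , lift (fromWitness (i₀ , refl))) (b , Value≤b)
    s = proj₁ supremumOfValues
    Near = Σ[ k ∈ I ] s < f k + ε
    s-ε<s : s - ε < s
    s-ε<s = begin-strict
      s - ε      ≈⟨ +-identityʳ _ ⟨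
      s - ε + 0# <⟨ +-monoʳ-< (s - ε) 0<ε ⟩
      s - ε + ε  ≈⟨ solve 2 (λ s e → s :- e :+ e := s) refl s ε ⟩
      s          ∎
    s-ε-bound : ¬ Near → ∀ x → Value x → x ≤ s - ε
    s-ε-bound none x (lift v) with toWitness v
    ... | j , fj≈x = 0≤y-x⇒x≤y (begin
      0#              ≤⟨ x≤y⇒0≤y-x (decidable-stable em (λ fj+ε≰s → none (j , ≰⇒> fj+ε≰s))) ⟩
      s - (f j + ε)   ≈⟨ +-congˡ (-‿cong (+-congʳ fj≈x)) ⟩
      s - (x + ε)     ≈⟨ solve 3 (λ s x e → s :- (x :+ e) := s :- e :- x) refl s x ε ⟩
      s - ε - x       ∎)
    near : Dec Near → Σ[ k ∈ I ] ∀ j → f j < f k + ε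
    near (yes (k , s<fk+ε)) = k , λ j → begin-strict
      f j     ≤⟨ proj₁ (proj₂ supremumOfValues) (f j) (lift (fromWitness (j , refl))) ⟩
      s       <⟨ s<fk+ε ⟩
      f k + ε ∎
    near (no none) = contradiction (proj₂ (proj₂ supremumOfValues) (s - ε) (s-ε-bound none)) (<⇒≱ s-ε<s)

  -- If `x` were positive, its multiples would be bounded by 1; but adding `x` to a multiple within
  -- `x` of their supremum gives another multiple, a contradiction.
  infinitesimal : (∀ {p} → ExcludedMiddle p) → ∀ {x} → (∀ n → NonZero n → x < 1/ n) → x ≤ 0#
  infinitesimal em {x} x<1/n = decidable-stable em λ x≰0 →
    -- The multiples start at `x` itself because the bound on them uses `1/ suc n`; nothing is known
    -- about `1/ 0`.
    let (k , near) = near-supremum em (λ n → fromℕ (suc n) * x) {1#} 0 nx≤1 (≰⇒> x≰0) in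
    <⇒≱ (near (suc k)) (≤-reflexive (begin-equality
      fromℕ (suc k) * x + x     ≈⟨ +-comm _ _ ⟩
      x + fromℕ (suc k) * x     ≈⟨ +-congʳ (*-identityˡ x) ⟨
      1# * x + fromℕ (suc k) * x ≈⟨ distribʳ x 1# (fromℕ (suc k)) ⟨
      fromℕ (suc (suc k)) * x   ∎))
    where
    nx≤1 : ∀ n → fromℕ (suc n) * x ≤ 1#
    nx≤1 n = begin
      fromℕ (suc n) * x        ≤⟨ *-monoʳ (fromℕ-nonNeg (suc n)) (<⇒≤ (x<1/n (suc n) _)) ⟩
      fromℕ (suc n) * 1/ suc n ≈⟨ ⁻¹-inverseʳ _ (proj₂ (+-pos-nonNeg 0<1 (fromℕ-nonNeg n)) ∘ sym) ⟩
      1#                       ∎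

-- Disjointness and refinement in a Boolean algebra.

module Refinement {c ℓ₁ ℓ₂ a ℓ} (R : CompleteOrderedField c ℓ₁ ℓ₂) (𝔹 : BooleanAlgebra a ℓ) where

  open OrderedField R
  open Regularity R 𝔹 public
    using (𝕊; _≋_; _∪_; _∩_; Ω; ∅; _⊆_; Additive; Probability; Partition; elements; ⋃; _≼_
          ; PartitionFunction; AbsolutelyContinuous; ∣_∣ᶠ; δ; 𝔇)
  open BooleanAlgebra 𝔹
    using (∨-cong; ∧-congˡ; ∧-congʳ; ∨-congˡ; ∨-congʳ; ∨-comm; ∨-assoc; ∧-comm; ∧-assoc
          ; ∧-absorbs-∨; ∧-distribˡ-∨; ∨-complementʳ; ∧-complementʳ)
    renaming (¬_ to _ᶜ; refl to ≋-refl; sym to ≋-sym; trans to ≋-trans)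
  open BooleanAlgebraProperties 𝔹
    using (∨-idem; ∧-idem; ∧-zeroʳ; ∧-identityˡ; ∧-identityʳ)

  Disjoint : 𝕊 → 𝕊 → Set ℓ
  Disjoint σ τ = σ ∩ τ ≋ ∅

  ⊆-refl : ∀ {σ} → σ ⊆ σ
  ⊆-refl {σ} = ∨-idem σ

  ⊆-trans : ∀ {ρ σ τ} → ρ ⊆ σ → σ ⊆ τ → ρ ⊆ τ
  ⊆-trans {ρ} {σ} {τ} ρ⊆σ σ⊆τ =
    ≋-trans (∨-congˡ (≋-sym σ⊆τ)) (≋-trans (≋-sym (∨-assoc ρ σ τ)) (≋-trans (∨-congʳ ρ⊆σ) σ⊆τ))

  σ⊆σ∪τ : ∀ σ τ → σ ⊆ σ ∪ τ
  σ⊆σ∪τ σ τ = ≋-trans (≋-sym (∨-assoc σ σ τ)) (∨-congʳ (∨-idem σ))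

  τ⊆σ∪τ : ∀ σ τ → τ ⊆ σ ∪ τ
  τ⊆σ∪τ σ τ = ≋-trans (∨-congˡ (∨-comm σ τ)) (≋-trans (σ⊆σ∪τ τ σ) (∨-comm τ σ))

  ⊆⇒∩ : ∀ {σ τ} → σ ⊆ τ → σ ∩ τ ≋ σ
  ⊆⇒∩ {σ} {τ} σ⊆τ = ≋-trans (∧-congˡ (≋-sym σ⊆τ)) (∧-absorbs-∨ σ τ)

  Disjoint-⊆ : ∀ {ρ σ τ} → σ ⊆ τ → Disjoint τ ρ → Disjoint ρ σ
  Disjoint-⊆ {ρ} {σ} {τ} σ⊆τ τρ =
    ≋-trans (∧-congˡ (≋-sym (≋-trans (∧-comm τ σ) (⊆⇒∩ σ⊆τ))))
      (≋-trans (≋-sym (∧-assoc ρ τ σ))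
        (≋-trans (∧-congʳ (≋-trans (∧-comm ρ τ) τρ)) (≋-trans (∧-comm ∅ σ) (∧-zeroʳ σ))))

  Disjoint-∪ : ∀ {ρ σ τ} → Disjoint ρ σ → Disjoint ρ τ → Disjoint ρ (σ ∪ τ)
  Disjoint-∪ {ρ} {σ} {τ} ρσ ρτ =
    ≋-trans (∧-distribˡ-∨ ρ σ τ) (≋-trans (∨-cong ρσ ρτ) (∨-idem ∅))

  Disjoint-∩ : ∀ {σ τ} ρ → Disjoint σ τ → Disjoint (ρ ∩ σ) (ρ ∩ τ)
  Disjoint-∩ {σ} {τ} ρ στ = ≋-trans (∧-congʳ (∧-comm ρ σ)) (≋-trans (∧-assoc σ ρ (ρ ∩ τ))
    (≋-trans (∧-congˡ (≋-trans (≋-sym (∧-assoc ρ ρ τ)) (≋-trans (∧-congʳ (∧-idem ρ)) (∧-comm ρ τ))))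
      (≋-trans (≋-sym (∧-assoc σ τ ρ)) (≋-trans (∧-congʳ στ) (≋-trans (∧-comm ∅ ρ) (∧-zeroʳ ρ))))))

  Disjoint-⋃ : ∀ {ρ xs} → All (Disjoint ρ) xs → Disjoint ρ (⋃ xs)
  Disjoint-⋃ [] = ∧-zeroʳ _
  Disjoint-⋃ (ρσ ∷ ρxs) = Disjoint-∪ ρσ (Disjoint-⋃ ρxs)

  elements⊆⋃ : ∀ xs → All (_⊆ ⋃ xs) xs
  elements⊆⋃ [] = []
  elements⊆⋃ (σ ∷ xs) = σ⊆σ∪τ σ (⋃ xs) ∷ All.map (λ τ⊆ → ⊆-trans τ⊆ (τ⊆σ∪τ σ (⋃ xs))) (elements⊆⋃ xs)

  ≼-refl : ∀ {𝒜} → 𝒜 ≼ 𝒜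
  ≼-refl = record
    { sameUnion = ≋-refl
    ; contained = All.tabulate (Any.map (λ { ≡.refl → ⊆-refl }))
    }

  ≼-trans : ∀ {𝒜 ℬ 𝒞} → 𝒜 ≼ ℬ → ℬ ≼ 𝒞 → 𝒜 ≼ 𝒞
  ≼-trans 𝒜≼ℬ ℬ≼𝒞 = record
    { sameUnion = ≋-trans (𝒜≼ℬ .sameUnion) (ℬ≼𝒞 .sameUnion)
    ; contained = All.map (λ σ∈ → let (τ∈ , σ⊆τ) = All.lookupAny (𝒜≼ℬ .contained) σ∈ in
                                  Any.map (⊆-trans σ⊆τ) τ∈) (ℬ≼𝒞 .contained)
    }
    where open _≼_

  -- Lets absolute continuity, which speaks of partitions, be applied to a single element.
  singleton : 𝕊 → Partition
  singleton σ = record { elements = σ ∷ [] ; unique = [] ∷ [] ; disjoint = [] ∷ [] }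

  -- Additive functions on partitions, and their variation.

  module Additivity {ν : 𝕊 → Carrier} (additive : Additive ν) where

    open Additive additive public renaming (cong to ν-cong)

    ν-null : ∀ {σ} → σ ≋ ∅ → ν σ ≈ 0#
    ν-null σ≋∅ = trans (ν-cong σ≋∅) ν-∅

    ν-disjoint-∪ : ∀ {σ τ} → Disjoint σ τ → ν (σ ∪ τ) ≈ ν σ + ν τ
    ν-disjoint-∪ {σ} {τ} στ = begin-equality
      ν (σ ∪ τ)               ≈⟨ ν-∪ σ τ ⟩
      ν σ + ν τ - ν (σ ∩ τ)   ≈⟨ +-congˡ (-‿cong (trans (ν-null στ) (sym (-‿inverseʳ 0#)))) ⟩
      ν σ + ν τ - (0# - 0#)   ≈⟨ solve 2 (λ s z → s :- (z :- z) := s) refl (ν σ + ν τ) 0# ⟩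
      ν σ + ν τ               ∎

    ν-split : ∀ σ τ → ν σ ≈ ν (σ ∩ τ) + ν (σ ∩ (τ ᶜ))
    ν-split σ τ = begin-equality
      ν σ                           ≈⟨ ν-cong (≋-trans (≋-sym (∧-distribˡ-∨ σ τ (τ ᶜ)))
                                         (≋-trans (∧-congˡ (∨-complementʳ τ)) (∧-identityʳ σ))) ⟨
      ν (σ ∩ τ ∪ σ ∩ (τ ᶜ))         ≈⟨ ν-disjoint-∪ (Disjoint-∩ σ (∧-complementʳ τ)) ⟩
      ν (σ ∩ τ) + ν (σ ∩ (τ ᶜ))     ∎

    ν-∩⋃ : ∀ τ {xs} → AllPairs Disjoint xs → ν (τ ∩ ⋃ xs) ≈ ∑ (λ σ → ν (τ ∩ σ)) xs
    ν-∩⋃ τ [] = ν-null (∧-zeroʳ τ)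
    ν-∩⋃ τ {σ ∷ xs} (σxs ∷ disjoint) = begin-equality
      ν (τ ∩ (σ ∪ ⋃ xs))                     ≈⟨ ν-cong (∧-distribˡ-∨ τ σ (⋃ xs)) ⟩
      ν (τ ∩ σ ∪ τ ∩ ⋃ xs)                   ≈⟨ ν-disjoint-∪ (Disjoint-∩ τ (Disjoint-⋃ σxs)) ⟩
      ν (τ ∩ σ) + ν (τ ∩ ⋃ xs)               ≈⟨ +-congˡ (ν-∩⋃ τ disjoint) ⟩
      ν (τ ∩ σ) + ∑ (λ σ → ν (τ ∩ σ)) xs     ∎

    -- Only the element containing σ meets σ.
    weighted-parent : ∀ (h : 𝕊 → Carrier) {σ ts} → AllPairs Disjoint ts → (σ∈ : Any (σ ⊆_) ts) →
                      ∑ (λ τ → h τ * ν (τ ∩ σ)) ts ≈ h (Any.lookup σ∈) * ν σ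
    weighted-parent h {σ} {τ ∷ ts} (τts ∷ _) (here σ⊆τ) = begin-equality
      h τ * ν (τ ∩ σ) + ∑ (λ τ → h τ * ν (τ ∩ σ)) ts
        ≈⟨ +-cong (*-congˡ (ν-cong (≋-trans (∧-comm τ σ) (⊆⇒∩ σ⊆τ))))
             (∑-zero (All.map (λ τρ → trans (*-congˡ (ν-null (Disjoint-⊆ σ⊆τ τρ))) (zeroʳ _)) τts)) ⟩
      h τ * ν σ + 0#
        ≈⟨ +-identityʳ _ ⟩
      h τ * ν σ ∎
    weighted-parent h {σ} {τ ∷ ts} (τts ∷ disjoint) (there σ∈) = begin-equality
      h τ * ν (τ ∩ σ) + ∑ (λ τ → h τ * ν (τ ∩ σ)) ts
        ≈⟨ +-cong (trans (*-congˡ (ν-null τσ)) (zeroʳ (h τ))) (weighted-parent h disjoint σ∈) ⟩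
      0# + h (Any.lookup σ∈) * ν σ
        ≈⟨ +-identityˡ _ ⟩
      h (Any.lookup σ∈) * ν σ ∎
      where
      τσ : Disjoint τ σ
      τσ = let (τρ , σ⊆ρ) = All.lookupAny τts σ∈ in Disjoint-⊆ σ⊆ρ (≋-trans (∧-comm _ τ) τρ)

    -- Expanding each term over all intersections `τ ∩ σ` gives a double sum that can be summed over
    -- either partition first. Hence the affine expressions in the energy do not change under
    -- refinement as long as their slopes are kept.
    ∑-refine : ∀ (h : 𝕊 → Carrier) {𝒜 ℬ} (𝒜≼ℬ : 𝒜 ≼ ℬ) →
               ∑ (λ p → h (Any.lookup (proj₂ p)) * ν (proj₁ p)) (All.toList (_≼_.contained 𝒜≼ℬ))
               ≈ ∑ (λ τ → h τ * ν τ) (elements 𝒜)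
    ∑-refine h {𝒜} {ℬ} 𝒜≼ℬ = begin-equality
      ∑ (λ p → h (Any.lookup (proj₂ p)) * ν (proj₁ p)) (All.toList contained)
        ≈⟨ ∑-cong (λ p → weighted-parent h (Partition.disjoint 𝒜) (proj₂ p)) (All.toList contained) ⟨
      ∑ (λ p → ∑ (λ τ → h τ * ν (τ ∩ proj₁ p)) (elements 𝒜)) (All.toList contained)
        ≈⟨ ∑-toList (λ σ → ∑ (λ τ → h τ * ν (τ ∩ σ)) (elements 𝒜)) contained ⟩
      ∑ (λ σ → ∑ (λ τ → h τ * ν (τ ∩ σ)) (elements 𝒜)) (elements ℬ)
        ≈⟨ ∑-swap (λ σ τ → h τ * ν (τ ∩ σ)) (elements ℬ) (elements 𝒜) ⟩
      ∑ (λ τ → ∑ (λ σ → h τ * ν (τ ∩ σ)) (elements ℬ)) (elements 𝒜)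
        ≈⟨ ∑-cong-All (All.map fibre (elements⊆⋃ (elements 𝒜))) ⟩
      ∑ (λ τ → h τ * ν τ) (elements 𝒜) ∎
      where
      open _≼_ 𝒜≼ℬ
      -- The pieces `τ ∩ σ` exhaust `τ` because the two partitions have the same union.
      fibre : ∀ {τ} → τ ⊆ ⋃ (elements 𝒜) → ∑ (λ σ → h τ * ν (τ ∩ σ)) (elements ℬ) ≈ h τ * ν τ
      fibre {τ} τ⊆ = begin-equality
        ∑ (λ σ → h τ * ν (τ ∩ σ)) (elements ℬ)   ≈⟨ ∑-* (h τ) (λ σ → ν (τ ∩ σ)) (elements ℬ) ⟩
        h τ * ∑ (λ σ → ν (τ ∩ σ)) (elements ℬ)   ≈⟨ *-congˡ (ν-∩⋃ τ (Partition.disjoint ℬ)) ⟨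
        h τ * ν (τ ∩ ⋃ (elements ℬ))             ≈⟨ *-congˡ (ν-cong (≋-trans (∧-congˡ (≋-sym sameUnion)) (⊆⇒∩ τ⊆))) ⟩
        h τ * ν τ                                ∎

    -- α and β are the unions of the elements on which ν is nonnegative,
    -- respectively negative.
    variation-split : ∀ {xs} → AllPairs Disjoint xs →
      Σ[ α ∈ 𝕊 ] Σ[ β ∈ 𝕊 ] (∑ ∣ ν ∣ᶠ xs ≈ ν α - ν β) ×
      -- Strengthens the induction: the next element is disjoint from all of `xs`, hence can be
      -- joined additively to either union.
      (∀ {ρ} → All (Disjoint ρ) xs → Disjoint ρ α × Disjoint ρ β)
    variation-split [] = ∅ , ∅ , sym (-‿inverseʳ (ν ∅)) , λ _ → ∧-zeroʳ _ , ∧-zeroʳ _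
    variation-split {σ ∷ xs} (σxs ∷ disjoint) with variation-split disjoint | ∣∣-sign (ν σ)
    ... | α , β , eq , avoid | inj₁ (_ , ∣νσ∣≈νσ) = σ ∪ α , β , (begin-equality
        ∣ ν σ ∣ + ∑ ∣ ν ∣ᶠ xs ≈⟨ +-cong ∣νσ∣≈νσ eq ⟩
        ν σ + (ν α - ν β)     ≈⟨ +-assoc _ _ _ ⟨
        ν σ + ν α - ν β       ≈⟨ +-congʳ (ν-disjoint-∪ (proj₁ (avoid σxs))) ⟨
        ν (σ ∪ α) - ν β       ∎)
      , λ { (ρσ ∷ ρxs) → let (ρα , ρβ) = avoid ρxs in Disjoint-∪ ρσ ρα , ρβ }
    ... | α , β , eq , avoid | inj₂ (_ , ∣νσ∣≈-νσ) = α , σ ∪ β , (begin-equality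
        ∣ ν σ ∣ + ∑ ∣ ν ∣ᶠ xs ≈⟨ +-cong ∣νσ∣≈-νσ eq ⟩
        - ν σ + (ν α - ν β)   ≈⟨ solve 3 (λ s a b → :- s :+ (a :- b) := a :- (s :+ b)) refl (ν σ) (ν α) (ν β) ⟩
        ν α - (ν σ + ν β)     ≈⟨ +-congˡ (-‿cong (ν-disjoint-∪ (proj₂ (avoid σxs)))) ⟨
        ν α - ν (σ ∪ β)       ∎)
      , λ { (ρσ ∷ ρxs) → let (ρα , ρβ) = avoid ρxs in ρα , Disjoint-∪ ρσ ρβ }

    -- However many elements there are, the variation is a difference of just two values of ν.
    variation-bounded : ∀ {C} → (∀ σ → ∣ ν σ ∣ ≤ C) → (𝒜 : Partition) → ∑ ∣ ν ∣ᶠ (elements 𝒜) ≤ C + C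
    variation-bounded {C} ν≤C 𝒜 with variation-split (Partition.disjoint 𝒜)
    ... | α , β , eq , _ = begin
      ∑ ∣ ν ∣ᶠ (elements 𝒜) ≈⟨ eq ⟩
      ν α - ν β             ≤⟨ +-mono (x≤∣x∣ (ν α)) (-x≤∣x∣ (ν β)) ⟩
      ∣ ν α ∣ + ∣ ν β ∣     ≤⟨ +-mono (ν≤C α) (ν≤C β) ⟩
      C + C                 ∎

    -- The `σ ∩ τ` are exactly the elements contained in `σ`; quantifying over `τ` avoids carrying
    -- proofs of containment.
    BoundedWithin : 𝕊 → Set (c ⊔ ℓ₂ ⊔ a)
    BoundedWithin σ = Σ[ C ∈ Carrier ] ∀ τ → ∣ ν (σ ∩ τ) ∣ ≤ C

    -- Used contrapositively: if ν is unbounded within `σ` but bounded within one part, it is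
    -- unbounded within the other.
    BoundedWithin-split : ∀ {σ} τ → BoundedWithin (σ ∩ τ) → BoundedWithin (σ ∩ (τ ᶜ)) → BoundedWithin σ
    BoundedWithin-split {σ} τ (C , ≤C) (C′ , ≤C′) = C + C′ , λ ρ → begin
      ∣ ν (σ ∩ ρ) ∣                                   ≤⟨ ∣∣-cong (ν-split (σ ∩ ρ) τ) ⟩
      ∣ ν ((σ ∩ ρ) ∩ τ) + ν ((σ ∩ ρ) ∩ (τ ᶜ)) ∣           ≤⟨ ∣∣-+ _ _ ⟩
      ∣ ν ((σ ∩ ρ) ∩ τ) ∣ + ∣ ν ((σ ∩ ρ) ∩ (τ ᶜ)) ∣       ≤⟨ +-mono (∣∣-cong (ν-cong (∩-swap σ ρ τ))) (∣∣-cong (ν-cong (∩-swap σ ρ (τ ᶜ)))) ⟩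
      ∣ ν ((σ ∩ τ) ∩ ρ) ∣ + ∣ ν ((σ ∩ (τ ᶜ)) ∩ ρ) ∣       ≤⟨ +-mono (≤C ρ) (≤C′ ρ) ⟩
      C + C′                                          ∎
      where
      ∩-swap : ∀ α β γ → (α ∩ β) ∩ γ ≋ (α ∩ γ) ∩ β
      ∩-swap α β γ = ≋-trans (∧-assoc α β γ) (≋-trans (∧-congˡ (∧-comm β γ)) (≋-sym (∧-assoc α γ β)))

  -- Consequences of absolute continuity.

  module _ {μ ν : 𝕊 → Carrier} (probability : Probability μ) (ν-additive : Additive ν)
           (absolutelyContinuous : AbsolutelyContinuous μ ν) where

    open Probability probability
    private
      module M = Additivity additive
    open Additivity ν-additive

    -- If ν were unbounded, take σ on which it is unbounded and with μ σ within
    -- 1/D of the infimum.  Splitting σ in two, ν is unbounded on one part, so the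
    -- other one has measure below 1/D, hence small ν; so ν is bounded on σ.
    bounded : (∀ {p} → ExcludedMiddle p) → Σ[ C ∈ Carrier ] ∀ σ → ∣ ν σ ∣ ≤ C
    -- The tolerance 1 is arbitrary; any fixed bound on the elements of small measure would do.
    bounded em with absolutelyContinuous 1 _
    ... | D , D≢0 , continuous =
      let (C , ≤C) = decidable-stable em bounded-Ω
      in C , λ σ → ≤-trans (∣∣-cong (ν-cong (≋-sym (∧-identityˡ σ)))) (≤C σ)
      where
      small : ∀ {σ} → μ σ < 1/ D → ∣ ν σ ∣ ≤ 1/ 1
      small {σ} μσ<1/D = begin
        ∣ ν σ ∣      ≈⟨ +-identityʳ _ ⟨
        ∣ ν σ ∣ + 0# ≤⟨ <⇒≤ (continuous (singleton σ) (begin-strict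
          μ σ + 0# ≈⟨ +-identityʳ _ ⟩
          μ σ      <⟨ μσ<1/D ⟩
          1/ D     ∎)) ⟩
        1/ 1         ∎
      bounded-Ω : ¬ ¬ BoundedWithin Ω
      bounded-Ω unbounded-Ω with near-supremum em {I = Σ[ σ ∈ 𝕊 ] ¬ BoundedWithin σ} (λ (σ , _) → - μ σ)
        (Ω , unbounded-Ω) (λ (σ , _) → ≤-trans (neg-mono (0≤μ σ)) (≤-reflexive -0≈0)) (1/-pos D D≢0)
        where
        -0≈0 : - 0# ≈ 0#
        -0≈0 = trans (sym (+-identityˡ (- 0#))) (-‿inverseʳ 0#)
      ... | (σ , unbounded) , near = unbounded (∣ ν σ ∣ + 1/ 1 , bound)
        where
        complement-small : ∀ {α β} → μ σ ≈ μ α + μ β → ¬ BoundedWithin α → ∣ ν β ∣ ≤ 1/ 1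
        complement-small {α} {β} split unbounded-α = small (begin-strict
          μ β                      ≈⟨ solve 2 (λ a b → b := (a :+ b) :- a) refl (μ α) (μ β) ⟩
          μ α + μ β - μ α          <⟨ +-monoʳ-< _ (near (α , unbounded-α)) ⟩
          μ α + μ β + (- μ σ + 1/ D) ≈⟨ +-congʳ split ⟨
          μ σ + (- μ σ + 1/ D)     ≈⟨ solve 2 (λ s d → s :+ (:- s :+ d) := d) refl (μ σ) (1/ D) ⟩
          1/ D                     ∎)
        bound : ∀ τ → ∣ ν (σ ∩ τ) ∣ ≤ ∣ ν σ ∣ + 1/ 1
        bound τ with em {P = BoundedWithin (σ ∩ τ)}
        ... | yes bounded-∩ = begin
          ∣ ν (σ ∩ τ) ∣ ≤⟨ complement-small (trans (M.ν-split σ τ) (+-comm _ _)) (unbounded ∘ BoundedWithin-split τ bounded-∩) ⟩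
          1/ 1          ≈⟨ +-identityˡ _ ⟨
          0# + 1/ 1     ≤⟨ +-monoˡ-≤ (1/ 1) (∣∣-nonNeg (ν σ)) ⟩
          ∣ ν σ ∣ + 1/ 1 ∎
        -- Here the complementary part is the small one, so `ν (σ ∩ τ)` is within `1/ 1` of the
        -- fixed value `ν σ`.
        ... | no unbounded-∩ = begin
          ∣ ν (σ ∩ τ) ∣                        ≤⟨ ∣∣-cong (trans (solve 2 (λ x y → x := (x :+ y) :- y) refl _ _)
                                                   (+-congʳ (sym (ν-split σ τ)))) ⟩
          ∣ ν σ - ν (σ ∩ (τ ᶜ)) ∣              ≤⟨ ∣∣-+ _ _ ⟩
          ∣ ν σ ∣ + ∣ - ν (σ ∩ (τ ᶜ)) ∣        ≤⟨ +-monoʳ _ (∣x∣≤ (-x≤∣x∣ _) (≤-trans (≤-reflexive (neg-involutive _)) (x≤∣x∣ _))) ⟩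
          ∣ ν σ ∣ + ∣ ν (σ ∩ (τ ᶜ)) ∣          ≤⟨ +-monoʳ _ (complement-small (M.ν-split σ τ) unbounded-∩) ⟩
          ∣ ν σ ∣ + 1/ 1                       ∎

    -- Where `μ σ` vanishes the density is arbitrary, but absolute continuity puts `∣ ν σ ∣` below
    -- every `1/ n`, so both sides are zero. Later computations then need no case for null elements.
    δ-* : (∀ {p} → ExcludedMiddle p) → ∀ σ → ν σ ≈ δ μ ν σ * μ σ
    δ-* em σ with em {P = μ σ ≈ 0#}
    ... | no μσ≉0 = begin-equality
      ν σ                     ≈⟨ *-identityʳ (ν σ) ⟨
      ν σ * 1#                ≈⟨ *-congˡ (⁻¹-inverseʳ (μ σ) μσ≉0) ⟨
      ν σ * (μ σ * μ σ ⁻¹)    ≈⟨ *-congˡ (*-comm (μ σ) (μ σ ⁻¹)) ⟩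
      ν σ * (μ σ ⁻¹ * μ σ)    ≈⟨ *-assoc (ν σ) (μ σ ⁻¹) (μ σ) ⟨
      ν σ * μ σ ⁻¹ * μ σ      ∎
    ... | yes μσ≈0 = begin-equality
      ν σ                     ≈⟨ antisym (≤-trans (x≤∣x∣ (ν σ)) ∣νσ∣≤0) 0≤νσ ⟩
      0#                      ≈⟨ zeroʳ (δ μ ν σ) ⟨
      δ μ ν σ * 0#            ≈⟨ *-congˡ μσ≈0 ⟨
      δ μ ν σ * μ σ           ∎
      where
      ∣νσ∣≤0 : ∣ ν σ ∣ ≤ 0#
      ∣νσ∣≤0 = infinitesimal em λ n n≢0 → let (D , D≢0 , continuous) = absolutelyContinuous n n≢0 in begin-strict
        ∣ ν σ ∣      ≈⟨ +-identityʳ _ ⟨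
        ∣ ν σ ∣ + 0# <⟨ continuous (singleton σ) (begin-strict
          μ σ + 0# ≈⟨ trans (+-identityʳ _) μσ≈0 ⟩
          0#       <⟨ 1/-pos D D≢0 ⟩
          1/ D     ∎) ⟩
        1/ n         ∎
      0≤νσ : 0# ≤ ν σ
      0≤νσ = ≤-trans (0≤-x (≤-trans (-x≤∣x∣ (ν σ)) ∣νσ∣≤0)) (≤-reflexive (neg-involutive (ν σ)))

  -- The energy and its increase under refinement.

  -- Huber's energy: on σ, with t the truncation of the density x = ν/μ to
  -- [-K, K], it is μ (2 t x - t²) = max {2 s ν - s² μ : |s| ≤ K}, which has linear
  -- growth in ν, while 2 s ν - s² μ is additive in σ.
  module Energy {μ ν : 𝕊 → Carrier} (probability : Probability μ) (ν-additive : Additive ν)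
                (δ-μ : ∀ σ → ν σ ≈ δ μ ν σ * μ σ) {K} (0≤K : 0# ≤ K) where

    open Probability probability
    private
      module M = Additivity additive
    open Additivity ν-additive

    truncation : ∀ σ → Clamp K (δ μ ν σ)
    truncation σ = clamp 0≤K (δ μ ν σ)

    t : 𝕊 → Carrier
    t σ = Clamp.value (truncation σ)

    -- The sign is kept inside the weight of `μ`, so that `∑-refine` applies to both summands.
    affine : Carrier → 𝕊 → Carrier
    affine s σ = (s + s) * ν σ + - (s * s) * μ σ

    energy : Partition → Carrier
    energy 𝒜 = ∑ (λ σ → affine (t σ) σ) (elements 𝒜)

    energy-≤ : ∀ 𝒜 → energy 𝒜 ≤ (K + K) * ∑ ∣ ν ∣ᶠ (elements 𝒜)
    energy-≤ 𝒜 = ≤-trans (∑-mono affine-≤ (elements 𝒜)) (≤-reflexive (∑-* (K + K) ∣ ν ∣ᶠ (elements 𝒜)))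
      where
      affine-≤ : ∀ σ → affine (t σ) σ ≤ (K + K) * ∣ ν σ ∣
      affine-≤ σ = begin
        (t σ + t σ) * ν σ + - (t σ * t σ) * μ σ
          ≈⟨ solve 3 (λ t n m → (t :+ t) :* n :+ :- (t :* t) :* m := t :* n :+ t :* n :- t :* t :* m) refl (t σ) (ν σ) (μ σ) ⟩
        t σ * ν σ + t σ * ν σ - t σ * t σ * μ σ
          ≤⟨ +-mono (+-mono tν≤ tν≤) (neg-mono (*-nonNeg (square-nonNeg (t σ)) (0≤μ σ))) ⟩
        K * ∣ ν σ ∣ + K * ∣ ν σ ∣ - 0#
          ≈⟨ +-congˡ (trans (sym (+-identityˡ _)) (-‿inverseʳ 0#)) ⟩
        K * ∣ ν σ ∣ + K * ∣ ν σ ∣ + 0#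
          ≈⟨ +-identityʳ _ ⟩
        K * ∣ ν σ ∣ + K * ∣ ν σ ∣
          ≈⟨ distribʳ ∣ ν σ ∣ K K ⟨
        (K + K) * ∣ ν σ ∣ ∎
        where
        tν≤ : t σ * ν σ ≤ K * ∣ ν σ ∣
        tν≤ = *-≤-∣∣ (ν σ) (Clamp.lower (truncation σ)) (Clamp.upper (truncation σ))

    -- With `π` the parent of `σ`, the contribution of `σ` to the squared L² distance between the
    -- truncated densities.
    gap : 𝕊 → 𝕊 → Carrier
    gap σ π = μ σ * ((t σ - t π) * (t σ - t π))

    gap-nonNeg : ∀ σ π → 0# ≤ gap σ π
    gap-nonNeg σ π = *-nonNeg (0≤μ σ) (square-nonNeg (t σ - t π))

    -- With x the density of `σ`, the two affine values differ by exactly the gap plus 2 μ (x - t σ)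
    -- (t σ - t π), which is nonnegative by `obtuse`.
    affine-gap : ∀ σ π → affine (t π) σ + gap σ π ≤ affine (t σ) σ
    affine-gap σ π = begin
      affine (t π) σ + gap σ π
        ≈⟨ +-identityʳ _ ⟨
      affine (t π) σ + gap σ π + 0#
        ≤⟨ +-monoʳ _ (*-nonNeg (+-nonNeg (0≤μ σ) (0≤μ σ))
             (Clamp.obtuse (truncation σ) (Clamp.lower (truncation π)) (Clamp.upper (truncation π)))) ⟩
      affine (t π) σ + gap σ π + (μ σ + μ σ) * ((δ μ ν σ - t σ) * (t σ - t π))
        ≈⟨ +-congʳ (+-congʳ (+-congʳ (*-congˡ (δ-μ σ)))) ⟩
      ((t π + t π) * (δ μ ν σ * μ σ) + - (t π * t π) * μ σ) + gap σ π
        + (μ σ + μ σ) * ((δ μ ν σ - t σ) * (t σ - t π))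
        ≈⟨ solve 4 (λ m x t s →
             ((s :+ s) :* (x :* m) :+ :- (s :* s) :* m) :+ m :* ((t :- s) :* (t :- s))
               :+ (m :+ m) :* ((x :- t) :* (t :- s))
             := (t :+ t) :* (x :* m) :+ :- (t :* t) :* m) refl (μ σ) (δ μ ν σ) (t σ) (t π) ⟩
      (t σ + t σ) * (δ μ ν σ * μ σ) + - (t σ * t σ) * μ σ
        ≈⟨ +-congʳ (*-congˡ (δ-μ σ)) ⟨
      affine (t σ) σ ∎

    module _ {𝒜 ℬ : Partition} (𝒜≼ℬ : 𝒜 ≼ ℬ) where

      open _≼_ 𝒜≼ℬ

      -- By `∑-refine`, the energy of 𝒜 can be computed on ℬ with the parents' slopes. Passing to
      -- each element's own optimal slope then gains at least its gap.
      energy-gap : energy 𝒜 + ∑ (λ p → gap (proj₁ p) (Any.lookup (proj₂ p))) (All.toList contained) ≤ energy ℬ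
      energy-gap = begin
        energy 𝒜 + ∑ (λ p → gap (proj₁ p) (Any.lookup (proj₂ p))) pairs
          ≈⟨ +-congʳ (∑-+ (λ τ → (t τ + t τ) * ν τ) (λ τ → - (t τ * t τ) * μ τ) (elements 𝒜)) ⟩
        _ + _ + ∑ (λ p → gap (proj₁ p) (Any.lookup (proj₂ p))) pairs
          ≈⟨ +-congʳ (+-cong (∑-refine (λ τ → t τ + t τ) 𝒜≼ℬ) (M.∑-refine (λ τ → - (t τ * t τ)) 𝒜≼ℬ)) ⟨
        _ + _ + ∑ (λ p → gap (proj₁ p) (Any.lookup (proj₂ p))) pairs
          ≈⟨ +-congʳ (∑-+ _ _ pairs) ⟨
        ∑ (λ p → affine (t (Any.lookup (proj₂ p))) (proj₁ p)) pairs + ∑ (λ p → gap (proj₁ p) (Any.lookup (proj₂ p))) pairs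
          ≈⟨ ∑-+ _ _ pairs ⟨
        ∑ (λ p → affine (t (Any.lookup (proj₂ p))) (proj₁ p) + gap (proj₁ p) (Any.lookup (proj₂ p))) pairs
          ≤⟨ ∑-mono (λ p → affine-gap (proj₁ p) (Any.lookup (proj₂ p))) pairs ⟩
        ∑ (λ p → affine (t (proj₁ p)) (proj₁ p)) pairs
          ≈⟨ ∑-toList (λ σ → affine (t σ) σ) contained ⟩
        energy ℬ ∎
        where pairs = All.toList contained

  -- From small energy gain to small deviation.

  -- Where the densities differ by e, either the truncated densities differ as
  -- well, or the finer density exceeds the cutoff 1/κ and Markov's inequality
  -- applies.
  module Deviation {μ ν : 𝕊 → Carrier} (probability : Probability μ) (ν-additive : Additive ν)
                   (δ-μ : ∀ σ → ν σ ≈ δ μ ν σ * μ σ)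
                   {κ e} (0<κ : 0# < κ) (0≤e : 0# ≤ e) where

    open Probability probability

    -- The truncation level exceeds Markov's threshold by `e`, so that a density below the threshold
    -- has the depth `e` demanded by `separate`.
    cutoff-nonNeg : 0# ≤ κ ⁻¹ + e
    cutoff-nonNeg = +-nonNeg (<⇒≤ (⁻¹-pos 0<κ)) 0≤e

    open Energy probability ν-additive δ-μ cutoff-nonNeg public

    markov : ∀ σ → κ ⁻¹ ≤ ∣ δ μ ν σ ∣ → μ σ ≤ κ * ∣ ν σ ∣
    markov σ large = begin
      μ σ                      ≈⟨ *-identityˡ (μ σ) ⟨
      1# * μ σ                 ≈⟨ *-congʳ (⁻¹-inverseʳ κ (proj₂ 0<κ ∘ sym)) ⟨
      κ * κ ⁻¹ * μ σ           ≈⟨ *-assoc κ (κ ⁻¹) (μ σ) ⟩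
      κ * (κ ⁻¹ * μ σ)         ≤⟨ *-monoʳ (<⇒≤ 0<κ) (*-monoˡ (0≤μ σ) large) ⟩
      κ * (∣ δ μ ν σ ∣ * μ σ)  ≤⟨ *-monoʳ (<⇒≤ 0<κ) ∣δ∣μ≤∣ν∣ ⟩
      κ * ∣ ν σ ∣              ∎
      where
      ∣δ∣μ≤∣ν∣ : ∣ δ μ ν σ ∣ * μ σ ≤ ∣ ν σ ∣
      ∣δ∣μ≤∣ν∣ with ∣∣-sign (δ μ ν σ)
      ... | inj₁ (_ , ∣δ∣≈δ) = begin
        ∣ δ μ ν σ ∣ * μ σ ≈⟨ *-congʳ ∣δ∣≈δ ⟩
        δ μ ν σ * μ σ     ≈⟨ δ-μ σ ⟨
        ν σ               ≤⟨ x≤∣x∣ (ν σ) ⟩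
        ∣ ν σ ∣           ∎
      ... | inj₂ (_ , ∣δ∣≈-δ) = begin
        ∣ δ μ ν σ ∣ * μ σ ≈⟨ *-congʳ ∣δ∣≈-δ ⟩
        - δ μ ν σ * μ σ   ≈⟨ solve 2 (λ x m → :- x :* m := :- (x :* m)) refl (δ μ ν σ) (μ σ) ⟩
        - (δ μ ν σ * μ σ) ≈⟨ -‿cong (δ-μ σ) ⟨
        - ν σ             ≤⟨ -x≤∣x∣ (ν σ) ⟩
        ∣ ν σ ∣           ∎

    -- The density of `σ` is its own truncation, so only that of `π` may move, and `separate`
    -- preserves the distance `e`.
    truncated-deviation : ∀ σ π → ∣ δ μ ν σ ∣ ≤ κ ⁻¹ → e ≤ ∣ δ μ ν σ - δ μ ν π ∣ → e * e * μ σ ≤ gap σ π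
    truncated-deviation σ π small deviates = begin
      e * e * μ σ                               ≤⟨ *-monoˡ (0≤μ σ) (square-mono-∣∣ 0≤e (Clamp.separate (truncation π) -K+e≤x x+e≤K deviates)) ⟩
      (δ μ ν σ - t π) * (δ μ ν σ - t π) * μ σ   ≈⟨ *-comm _ _ ⟩
      μ σ * ((δ μ ν σ - t π) * (δ μ ν σ - t π)) ≈⟨ *-congˡ (*-cong (+-congʳ t≈x) (+-congʳ t≈x)) ⟨
      gap σ π                                   ∎
      where
      x+e≤K : δ μ ν σ + e ≤ κ ⁻¹ + e
      x+e≤K = +-monoˡ-≤ e (≤-trans (x≤∣x∣ _) small)
      -K+e≤x : - (κ ⁻¹ + e) + e ≤ δ μ ν σ
      -K+e≤x = begin
        - (κ ⁻¹ + e) + e ≈⟨ solve 2 (λ k e → :- (k :+ e) :+ e := :- k) refl (κ ⁻¹) e ⟩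
        - (κ ⁻¹)         ≤⟨ neg-mono (≤-trans (-x≤∣x∣ _) small) ⟩
        - (- δ μ ν σ)    ≈⟨ neg-involutive _ ⟩
        δ μ ν σ          ∎
      x≤x+e : ∀ x → x ≤ x + e
      x≤x+e x = ≤-trans (≤-reflexive (sym (+-identityʳ x))) (+-monoʳ x 0≤e)
      t≈x : t σ ≈ δ μ ν σ
      t≈x = Clamp.fixed (truncation σ) (≤-trans (x≤x+e (- (κ ⁻¹ + e))) -K+e≤x) (≤-trans (x≤x+e (δ μ ν σ)) x+e≤K)

    -- Adding the bounds of the two cases gives a single inequality that can be summed without
    -- sorting the elements by case.
    deviation-≤ : ∀ σ π → e ≤ ∣ δ μ ν σ - δ μ ν π ∣ → e * e * μ σ ≤ e * e * κ * ∣ ν σ ∣ + gap σ π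
    deviation-≤ σ π deviates = [ below-cutoff , above-cutoff ]′ (total ∣ δ μ ν σ ∣ (κ ⁻¹))
      where
      Goal = e * e * μ σ ≤ e * e * κ * ∣ ν σ ∣ + gap σ π
      below-cutoff : ∣ δ μ ν σ ∣ ≤ κ ⁻¹ → Goal
      below-cutoff small = begin
        e * e * μ σ                     ≤⟨ truncated-deviation σ π small deviates ⟩
        gap σ π                         ≈⟨ +-identityˡ _ ⟨
        0# + gap σ π                    ≤⟨ +-monoˡ-≤ _ (*-nonNeg (*-nonNeg (square-nonNeg e) (<⇒≤ 0<κ)) (∣∣-nonNeg (ν σ))) ⟩
        e * e * κ * ∣ ν σ ∣ + gap σ π   ∎
      above-cutoff : κ ⁻¹ ≤ ∣ δ μ ν σ ∣ → Goal
      above-cutoff large = begin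
        e * e * μ σ                     ≤⟨ *-monoʳ (square-nonNeg e) (markov σ large) ⟩
        e * e * (κ * ∣ ν σ ∣)           ≈⟨ *-assoc (e * e) κ ∣ ν σ ∣ ⟨
        e * e * κ * ∣ ν σ ∣             ≈⟨ +-identityʳ _ ⟨
        e * e * κ * ∣ ν σ ∣ + 0#        ≤⟨ +-monoʳ _ (gap-nonNeg σ π) ⟩
        e * e * κ * ∣ ν σ ∣ + gap σ π   ∎

    parent : ∀ {ts} → Σ[ σ ∈ 𝕊 ] Any (σ ⊆_) ts → 𝕊
    parent p = Any.lookup (proj₂ p)

    -- After division by e², the Markov terms contribute at most `κ * V`, which is η, and the gaps
    -- contribute less than another η.
    deviation-small : ∀ {V η} → 0# < e → (∀ 𝒜 → ∑ ∣ ν ∣ᶠ (elements 𝒜) ≤ V) → κ * V ≈ η →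
      ∀ {𝒜 ℬ} (𝒜≼ℬ : 𝒜 ≼ ℬ) → energy ℬ < energy 𝒜 + e * e * η →
      ∀ {p} {P : Σ[ σ ∈ 𝕊 ] Any (σ ⊆_) (elements 𝒜) → Set p} (P? : ∀ q → Dec (P q)) →
      (∀ q → P q → e ≤ ∣ δ μ ν (proj₁ q) - δ μ ν (parent q) ∣) →
      ∑ μ (map proj₁ (filter P? (All.toList (_≼_.contained 𝒜≼ℬ)))) < η + η
    deviation-small {V} {η} 0<e variation≤V κV≈η {𝒜} {ℬ} 𝒜≼ℬ near P? P⇒deviates =
      ≰⇒> λ 2η≤ → <⇒≱ scaled (*-monoʳ (square-nonNeg e) 2η≤)
      where
      open _≼_ 𝒜≼ℬ
      pairs = All.toList contained
      deviating = map proj₁ (filter P? pairs)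
      gaps = ∑ (λ p → gap (proj₁ p) (parent p)) pairs
      -- Larger gaps would raise the energy of ℬ beyond the slack allowed by `near`; this also
      -- supplies the strict inequality in the conclusion.
      gaps< : gaps < e * e * η
      gaps< = ≰⇒> λ ε≤gaps → <⇒≱ near (≤-trans (+-monoʳ (energy 𝒜) ε≤gaps) (energy-gap 𝒜≼ℬ))
      0≤e²κ : 0# ≤ e * e * κ
      0≤e²κ = *-nonNeg (square-nonNeg e) (<⇒≤ 0<κ)
      scaled : e * e * ∑ μ deviating < e * e * (η + η)
      scaled = begin-strict
        e * e * ∑ μ deviating
          ≈⟨ ∑-* (e * e) μ deviating ⟨
        ∑ (λ σ → e * e * μ σ) deviating
          ≤⟨ ∑-filter-≤ P? (λ p Pp → deviation-≤ (proj₁ p) (parent p) (P⇒deviates p Pp))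
               (λ p → +-nonNeg (*-nonNeg 0≤e²κ (∣∣-nonNeg (ν (proj₁ p)))) (gap-nonNeg (proj₁ p) (parent p))) pairs ⟩
        ∑ (λ p → e * e * κ * ∣ ν (proj₁ p) ∣ + gap (proj₁ p) (parent p)) pairs
          ≈⟨ ∑-+ (λ p → e * e * κ * ∣ ν (proj₁ p) ∣) (λ p → gap (proj₁ p) (parent p)) pairs ⟩
        ∑ (λ p → e * e * κ * ∣ ν (proj₁ p) ∣) pairs + gaps
          ≈⟨ +-congʳ (trans (∑-toList (λ σ → e * e * κ * ∣ ν σ ∣) contained) (∑-* (e * e * κ) ∣ ν ∣ᶠ (elements ℬ))) ⟩
        e * e * κ * ∑ ∣ ν ∣ᶠ (elements ℬ) + gaps
          ≤⟨ +-monoˡ-≤ gaps (*-monoʳ 0≤e²κ (variation≤V ℬ)) ⟩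
        e * e * κ * V + gaps
          <⟨ +-monoʳ-< (e * e * κ * V) gaps< ⟩
        e * e * κ * V + e * e * η
          ≈⟨ +-congʳ (trans (*-assoc (e * e) κ V) (*-congˡ κV≈η)) ⟩
        e * e * η + e * e * η
          ≈⟨ distribˡ (e * e) η η ⟨
        e * e * (η + η) ∎

    -- One choice serves every 𝒞 refining ℬ, since 𝒞 refines 𝒜 too and so competes in the same
    -- supremum.
    near-maximal : (∀ {p} → ExcludedMiddle p) → ∀ {V ε} → (∀ 𝒜 → ∑ ∣ ν ∣ᶠ (elements 𝒜) ≤ V) → 0# < ε →
      ∀ 𝒜 → Σ[ ℬ ∈ Partition ] (𝒜 ≼ ℬ) × (∀ {𝒞} → ℬ ≼ 𝒞 → energy 𝒞 < energy ℬ + ε)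
    near-maximal em variation≤V 0<ε 𝒜 =
      let ((ℬ , 𝒜≼ℬ) , near) = near-supremum em {I = Σ[ ℬ ∈ Partition ] 𝒜 ≼ ℬ} (λ q → energy (proj₁ q))
            (𝒜 , ≼-refl) (λ q → ≤-trans (energy-≤ (proj₁ q))
              (*-monoʳ (+-nonNeg cutoff-nonNeg cutoff-nonNeg) (variation≤V (proj₁ q)))) 0<ε
      in ℬ , 𝒜≼ℬ , λ {𝒞} ℬ≼𝒞 → near (𝒞 , ≼-trans 𝒜≼ℬ ℬ≼𝒞)

    regular-refinement : (∀ {p} → ExcludedMiddle p) → ∀ {V η} → 0# < e → 0# < η →
      (∀ 𝒜 → ∑ ∣ ν ∣ᶠ (elements 𝒜) ≤ V) → κ * V ≈ η →
      ∀ 𝒜 → Σ[ ℬ ∈ Partition ] (𝒜 ≼ ℬ) × (∀ {𝒞} (ℬ≼𝒞 : ℬ ≼ 𝒞) →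
        ∀ {P : Σ[ σ ∈ 𝕊 ] Any (σ ⊆_) (elements ℬ) → Set ℓ₂} (P? : ∀ q → Dec (P q)) →
        (∀ q → P q → e ≤ ∣ δ μ ν (proj₁ q) - δ μ ν (parent q) ∣) →
        ∑ μ (map proj₁ (filter P? (All.toList (_≼_.contained ℬ≼𝒞)))) < η + η)
    regular-refinement em 0<e 0<η variation≤V κV≈η 𝒜 =
      -- The slack is e²η because a deviating element below Markov's threshold costs energy at least
      -- e² times its measure.
      let (ℬ , 𝒜≼ℬ , near) = near-maximal em variation≤V (*-pos (*-pos 0<e 0<e) 0<η) 𝒜
      in ℬ , 𝒜≼ℬ , λ ℬ≼𝒞 → deviation-small 0<e variation≤V κV≈η ℬ≼𝒞 (near ℬ≼𝒞)

  -- Choice of constants and conclusion.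

  regularity : (∀ {p} → ExcludedMiddle p) → ∀ {μ ν C η e} → Probability μ → Additive ν →
    (∀ σ → ν σ ≈ δ μ ν σ * μ σ) → (∀ σ → ∣ ν σ ∣ ≤ C) → 0# < e → 0# < η →
    ∀ 𝒜 → Σ[ ℬ ∈ Partition ] (𝒜 ≼ ℬ) × (∀ {𝒞} (ℬ≼𝒞 : ℬ ≼ 𝒞) →
      ∀ {P : Σ[ σ ∈ 𝕊 ] Any (σ ⊆_) (elements ℬ) → Set ℓ₂} (P? : ∀ q → Dec (P q)) →
      (∀ q → P q → e ≤ ∣ δ μ ν (proj₁ q) - δ μ ν (Any.lookup (proj₂ q)) ∣) →
      ∑ μ (map proj₁ (filter P? (All.toList (_≼_.contained ℬ≼𝒞)))) < η + η)
  regularity em {ν = ν} {C} probability ν-additive δ-μ ν≤C 0<e 0<η =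
    -- κ is η/V, the value at which the Markov terms use up exactly one η.
    let (κ , 0<κ , κV≈η) = quotient 0<η 0<V
    in Deviation.regular-refinement probability ν-additive δ-μ 0<κ (<⇒≤ 0<e) em 0<e 0<η variation≤V κV≈η
    where
    0≤C : 0# ≤ C
    0≤C = ≤-trans (∣∣-nonNeg (ν Ω)) (ν≤C Ω)
    -- The added 1 makes V positive even when `C` is zero, so that η can be divided by it.
    0<V : 0# < 1# + (C + C)
    0<V = +-pos-nonNeg 0<1 (+-nonNeg 0≤C 0≤C)
    variation≤V : ∀ ℬ → ∑ ∣ ν ∣ᶠ (elements ℬ) ≤ 1# + (C + C)
    variation≤V ℬ = begin
      ∑ ∣ ν ∣ᶠ (elements ℬ) ≤⟨ Additivity.variation-bounded ν-additive ν≤C ℬ ⟩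
      C + C                 ≈⟨ +-identityˡ (C + C) ⟨
      0# + (C + C)          ≤⟨ +-monoˡ-≤ (C + C) (<⇒≤ 0<1) ⟩
      1# + (C + C)          ∎

theorem5p4 : (em : ∀ {p : Level} → ExcludedMiddle p)
    {c ℓ₁ ℓ₂ a ℓ : Level}
    (R : CompleteOrderedField c ℓ₁ ℓ₂) (𝔹 : BooleanAlgebra a ℓ) →
    let open Regularity R 𝔹 in
    (μ : 𝕊 → ℝ) → Probability μ →
    (ν : 𝕊 → ℝ) → Additive ν → AbsolutelyContinuous μ ν →
    (𝒜 : Partition) (E D : ℕ) → NonZero E → NonZero D →
    (𝐁 : PartitionFunction) →
    Σ[ ℬ♯ ∈ Partition ] (𝒜 ≼ ℬ♯) ×
    (∀ (ℬ : Partition) (ℬ♯≼ℬ : ℬ♯ ≼ ℬ) → ℬ ≼ PartitionFunction.apply 𝐁 ℬ♯ →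
    sumOver μ (𝔇 em μ ν E ℬ♯ ℬ ℬ♯≼ℬ) < 1/ D)
theorem5p4 em R 𝔹 μ probability ν ν-additive absolutelyContinuous 𝒜 E D E≢0 D≢0 _ =
  let (η , 0<η , η+η≈1/D) = half (1/-pos D D≢0)
      (C , ν≤C) = bounded probability ν-additive absolutelyContinuous em
      (ℬ♯ , 𝒜≼ℬ♯ , small) = regularity em probability ν-additive
        (δ-* probability ν-additive absolutelyContinuous em) ν≤C (1/-pos E E≢0) 0<η 𝒜
  in ℬ♯ , 𝒜≼ℬ♯ , λ ℬ ℬ♯≼ℬ _ → begin-strict
    ∑ μ (𝔇 em μ ν E ℬ♯ ℬ ℬ♯≼ℬ)
      -- The predicate repeats the one local to `𝔇`; with `em` as its decision procedure, the
      -- filtered list is definitionally the one in `𝔇`.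
      <⟨ small ℬ♯≼ℬ {λ p → 1/ E ≤ ∣ δ μ ν (proj₁ p) - δ μ ν (Any.lookup (proj₂ p)) ∣}
           (λ _ → em) (λ _ deviates → deviates) ⟩
    η + η
      ≈⟨ η+η≈1/D ⟩
    1/ D ∎
  where
  open OrderedField R
  open Refinement R 𝔹
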